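{- Let $(M_{n,k})$ be defined for natural numbers $n\ge k\ge1$ by: $M_{n,1}=n$; $M_{k,k}=k$; and for $n\ge k>1$, $$M_{n+1,k}=R^{\,{\mathcal{R}_1(M_{n,k},\,k-1)\brack k-1}}(n+1,k).$$ Then for all natural numbers $n\ge k$, $\mathcal{R}_1(n,k)\le M_{2n-1,k}$.
   Context: $T_n=n(n+1)/2$, $T_0=0$. A finite set $X\subseteq\mathbb{N}$ with $|X|=T_n$, enumerated $x_1<\dots<x_{T_n}$, has $i$-th level $\{x_{T_{i-1}+1},\dots,x_{T_i}\}$ for $1\le i\le n$; $\triangle_n$ is the set of all such sets. For such sets, $X\le Y$ means $X\subseteq Y$ and every level of $X$ is contained in a single level of $Y$, distinct levels of $X$ being contained in distinct levels of $Y$; $\triangle_k(B)=\{Z\in\triangle_k:Z\le B\}$. For natural numbers $k\le p,q$, a completed game of Mines$_m(p,q,k)$ is a partition $\triangle_k(B)=X\sqcup Y$ with $B\in\triangle_m$; it is a win for player one if there is $Z\in\triangle_p(B)$ with $\triangle_k(Z)\subseteq X$, a win for player two if there is $Z\in\triangle_q(B)$ with $\triangle_k(Z)\subseteq Y$, and a draw otherwise. $\mathcal{R}_1(p,q,k)$ is the least $m\ge\max(p,q)$ such that no completed game of Mines$_m(p,q,k)$ is a draw, and $\mathcal{R}_1(n,k)=\mathcal{R}_1(n,n,k)$. The numbers ${n\brack k}$ are defined by ${n\brack0}={n\brack n}=1$ and ${n\brack k}={n-1\brack k}+\binom nk{n-1\brack k-1}$ for $0<k<n$. $R(n,k)$ is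 the least $N$ such that every 2-coloring of the $k$-element subsets of an $N$-element set admits an $n$-element subset all of whose $k$-element subsets have the same color; $R^1(n,k)=R(n,k)$ and $R^{l+1}(n,k)=R(R^{l}(n,k),k)$. -}

module Defs where

open import Data.Nat using (ℕ; zero; suc; _+_; _*_; _∸_; _≤_; _⊔_; _≡ᵇ_; _≤ᵇ_)
open import Data.Nat.Combinatorics using (_C_)
open import Data.Bool using (Bool; true; false; if_then_else_)
open import Data.List using (List; length; take; drop)
open import Data.List.Membership.Propositional using (_∈_)
open import Data.List.Relation.Unary.Linked using (Linked)
open import Data.Fin using (Fin; toℕ)
open import Data.Fin.Subset using (Subset; _⊆_; ∣_∣)
open import Data.Product using (Σ; ∃; _×_)
open import Data.Sum using (_⊎_)
open import Function.Definitions using (Injective)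
open import Relation.Binary.PropositionalEquality using (_≡_)

T : ℕ → ℕ
T zero    = 0
T (suc n) = T n + suc n

-- Finite subsets of ℕ are represented by their increasing enumeration
-- (a strictly increasing list).  Tri n X  means  X ∈ △_n.
Tri : ℕ → List ℕ → Set
Tri n X = Linked Data.Nat._<_ X × length X ≡ T n

-- The (i+1)-th level (i : Fin n, 0-based) of a set with T_n elements:
-- elements x_{T_i + 1}, …, x_{T_{i+1}}.
level : List ℕ → ℕ → List ℕ
level X i = take (suc i) (drop (T i) X)

Le : ℕ → ℕ → List ℕ → List ℕ → Set
Le a b X Y =
  (∀ x → x ∈ X → x ∈ Y) ×
  Σ (Fin a → Fin b) λ f → Injective _≡_ _≡_ f ×
    (∀ (i : Fin a) → ∀ x → x ∈ level X (toℕ i) → x ∈ level Y (toℕ (f i)))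

-- Player one (colour true = part X) wins the completed game given by
-- B ∈ △_m and the partition of △_k(B) described by the colouring c.
WinsWith : Bool → ℕ → ℕ → ℕ → List ℕ → (List ℕ → Bool) → Set
WinsWith b p k m B c =
  ∃ λ Z → Tri p Z × Le p m Z B ×
    (∀ W → Tri k W → Le k p W Z → c W ≡ b)

-- No completed game of Mines_m(p,q,k) is a draw.
-- (A partition △_k(B) = X ⊔ Y is the same as a colouring c of △_k(B):
--  X = {W | c W ≡ true}, Y = {W | c W ≡ false}.)
NoDraw : ℕ → ℕ → ℕ → ℕ → Set
NoDraw p q k m =
  ∀ B → Tri m B → ∀ (c : List ℕ → Bool) →
    WinsWith true p k m B c ⊎ WinsWith false q k m B c

IsR1 : ℕ → ℕ → ℕ → ℕ → Set
IsR1 p q k m =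
  (p ⊔ q ≤ m) × NoDraw p q k m ×
  (∀ m′ → p ⊔ q ≤ m′ → NoDraw p q k m′ → m ≤ m′)

RamseyProp : ℕ → ℕ → ℕ → Set
RamseyProp n k N =
  ∀ (c : Subset N → Bool) →
    ∃ λ (S : Subset N) → ∣ S ∣ ≡ n × ∃ λ (b : Bool) →
      ∀ (U : Subset N) → U ⊆ S → ∣ U ∣ ≡ k → c U ≡ b

IsRamsey : ℕ → ℕ → ℕ → Set
IsRamsey n k N = RamseyProp n k N × (∀ N′ → RamseyProp n k N′ → N ≤ N′)

Riter : (ℕ → ℕ → ℕ) → ℕ → ℕ → ℕ → ℕ
Riter R zero    n k = n
Riter R (suc l) n k = R (Riter R l n k) k

-- The numbers [n brack k]: [n,0] = [n,n] = 1,
-- [n,k] = [n-1,k] + C(n,k)·[n-1,k-1] for 0<k<n; (0 for k > n, unused).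
brack : ℕ → ℕ → ℕ
brack zero    zero    = 1
brack zero    (suc k) = 0
brack (suc n) zero    = 1
brack (suc n) (suc k) =
  if n ≡ᵇ k then 1 else brack n (suc k) + (suc n C suc k) * brack n k

-- M_{n,k} (meaningful for n ≥ k ≥ 1; value 0 elsewhere), given the
-- functions r1 (r1 n k = 𝓡_1(n,k)) and R (R n k = R(n,k)):
--   M_{n,1} = n,  M_{k,k} = k,
--   M_{n+1,k} = R^{[𝓡_1(M_{n,k},k-1) brack k-1]}(n+1,k)  for n ≥ k > 1.
M : (ℕ → ℕ → ℕ) → (ℕ → ℕ → ℕ) → ℕ → ℕ → ℕ
M r1 R zero    k             = 0
M r1 R (suc n) zero          = 0
M r1 R (suc n) (suc zero)    = suc n
M r1 R (suc n) (suc (suc j)) =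
  if suc n ≡ᵇ suc (suc j) then suc n
  else if suc (suc j) ≤ᵇ n
       then Riter R (brack (r1 (M r1 R n (suc (suc j))) (suc j)) (suc j))
                    (suc n) (suc (suc j))
       else 0

{-# OPTIONS --safe #-}

-- An Erdős–Rado stepping-up argument, one level at a time from the last. Let r = 𝓡₁(M_{N,k}, k−1) and
-- let K be the first r levels of a triangle with M_{N+1,k} levels. Each of the [r, k−1] elements S of
-- △_{k−1}(K) colours the k-subsets u of the last level by the colour of S ∪ u; the iterated Ramsey number
-- makes N+1 points of that level homogeneous for all these colourings at once. The colour now depends on
-- S only, and the definition of r yields a triangle with M_{N,k} levels on which it is constant. Repeating
-- this leaves a triangle with N levels where the colour of a k-triangle is determined by which level
-- contains its last level (for k = 1, by its only element). When N = 2n−1, a greedy choice of levels gives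
-- monochromatic triangles with p and q levels, one for each colour, where p + q ≥ 2n−1.
module Submission where

open import Defs
open import Data.Bool using (Bool; true; false)
open import Data.Fin using (Fin; toℕ; fromℕ<)
open import Data.Fin.Properties using (toℕ<n; toℕ-fromℕ<; toℕ-injective)
open import Data.Fin.Subset using (Subset; ∣_∣; inside; outside) renaming (_⊆_ to _⊆ˢ_)
open import Data.Fin.Subset.Properties using (out⊆; in⊆in; ∣p∣≤n; ∣p∣≡n⇒p≡⊤; ⊆⊤)
open import Data.List using (List; []; _∷_; _++_; length; take; drop; map; cartesianProductWith)
open import Data.List.Membership.Propositional using (_∈_)
open import Data.List.Membership.Propositional.Properties using (∈-++⁺ˡ; ∈-++⁺ʳ; ∈-map⁺; ∈-cartesianProductWith⁺)
open import Data.List.Properties using (length-++; length-take; length-drop; length-map; ∷-injective; take-all; take-[])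
open import Data.List.Relation.Binary.Pointwise using (Pointwise-≡⇒≡)
open import Data.List.Relation.Binary.Sublist.Heterogeneous using (Sublist; []; _∷_; _∷ʳ_; minimum)
import Data.List.Relation.Binary.Sublist.Heterogeneous.Properties as Sublist
open import Data.List.Relation.Binary.Sublist.Propositional using (_⊆_; lookup; ⊆-refl; ⊆-trans)
open import Data.List.Relation.Binary.Sublist.Propositional.Properties using (take-⊆; drop-⊆; All-resp-⊆) renaming (++⁺ to ⊆-++⁺; ++⁺ʳ to ⊆-++⁺ʳ)
open import Data.List.Relation.Unary.All using (All; []; _∷_)
import Data.List.Relation.Unary.All as All
open import Data.List.Relation.Unary.All.Properties using () renaming (map⁻ to All-map⁻)
open import Data.List.Relation.Unary.AllPairs using (AllPairs; []; _∷_)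
open import Data.List.Relation.Unary.Any using (here; there)
open import Data.List.Relation.Unary.Linked.Properties using (Linked⇒AllPairs; AllPairs⇒Linked)
open import Data.Nat using (ℕ; zero; suc; _+_; _*_; _∸_; _≤_; _<_; _⊓_; z≤n; s≤s; s≤s⁻¹; _≟_; _≤?_; _<?_)
open import Data.Nat.Combinatorics using (_C_; nCk+nC[k+1]≡[n+1]C[k+1]; nCn≡1)
open import Data.Nat.Properties hiding (_≟_; _≤?_; _<?_)
open import Data.Product using (∃; _×_; _,_; proj₁; proj₂)
open import Data.Sum using (_⊎_; inj₁; inj₂)
open import Data.Vec using ([]; _∷_; head)
open import Function using (_∘_)
open import Relation.Binary.Definitions using (tri<; tri≈; tri>)
open import Relation.Binary.PropositionalEquality
open import Relation.Nullary using (¬_; yes; no; contradiction)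
open import Relation.Nullary.Decidable using (dec-true; dec-false)

-- Sorted lists and their sublists

Sorted : List ℕ → Set
Sorted = AllPairs _<_

AllPairs-resp-⊆ : ∀ {A : Set} {R : A → A → Set} {xs ys} → xs ⊆ ys → AllPairs R ys → AllPairs R xs
AllPairs-resp-⊆ []         []        = []
AllPairs-resp-⊆ (y ∷ʳ s)   (_ ∷ ps)  = AllPairs-resp-⊆ s ps
AllPairs-resp-⊆ (refl ∷ s) (p ∷ ps)  = All-resp-⊆ s p ∷ AllPairs-resp-⊆ s ps

take-before-drop : ∀ {A : Set} {R : A → A → Set} {xs} m n {x y} → AllPairs R xs → m ≤ n →
  x ∈ take m xs → y ∈ drop n xs → R x y
take-before-drop (suc m) (suc n) (p ∷ ps) (s≤s m≤n) (here refl) y∈ = All.lookup p (lookup (drop-⊆ n _) y∈)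
take-before-drop (suc m) (suc n) (p ∷ ps) (s≤s m≤n) (there x∈)  y∈ = take-before-drop m n ps m≤n x∈ y∈

-- Compare the heads. If they agree, the rest of `xs` is strictly larger and avoids the head of
-- `ys`; if not, `x` occurs beyond `y`, and with it everything in `x ∷ xs`.
sorted-∈⇒⊆ : ∀ {xs ys} → Sorted xs → Sorted ys → (∀ x → x ∈ xs → x ∈ ys) → xs ⊆ ys
sorted-∈⇒⊆ {[]}     {ys}     sx sy f = minimum ys
sorted-∈⇒⊆ {x ∷ xs} {[]}     sx sy f with () ← f x (here refl)
sorted-∈⇒⊆ {x ∷ xs} {y ∷ ys} (px ∷ sx) (py ∷ sy) f with f x (here refl)
... | here refl = refl ∷ sorted-∈⇒⊆ sx sy tail
  where
  tail : ∀ z → z ∈ xs → z ∈ ys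
  tail z z∈ with f z (there z∈)
  ... | here refl = contradiction (All.lookup px z∈) (<-irrefl refl)
  ... | there q   = q
... | there x∈ys = y ∷ʳ sorted-∈⇒⊆ (px ∷ sx) sy later
  where
  later : ∀ z → z ∈ x ∷ xs → z ∈ ys
  later z (here refl) = x∈ys
  later z (there z∈) with f z (there z∈)
  ... | here refl = contradiction (<-trans (All.lookup py x∈ys) (All.lookup px z∈)) (<-irrefl refl)
  ... | there q   = q

take-+ : ∀ {A : Set} m n (xs : List A) → take m xs ++ take n (drop m xs) ≡ take (m + n) xs
take-+ zero    n xs       = refl
take-+ (suc m) n []       = take-[] n
take-+ (suc m) n (x ∷ xs) = cong (x ∷_) (take-+ m n xs)

++-injective : ∀ {A : Set} (xs {ys} : List A) {us vs} → length xs ≡ length ys →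
  xs ++ us ≡ ys ++ vs → xs ≡ ys × us ≡ vs
++-injective []       {[]}     _ eq   = refl , eq
++-injective (x ∷ xs) {y ∷ ys} l eq =
  let x≡y , eq′ = ∷-injective eq
      p   , q   = ++-injective xs (suc-injective l) eq′
  in cong₂ _∷_ x≡y p , q

-- Triangles are handled as stacks: lists of levels with the last level first, so that W ≤ Z
-- becomes the (heterogeneous) sublist relation over the sublist relation.

infix 4 _⊑_
_⊑_ : List (List ℕ) → List (List ℕ) → Set
_⊑_ = Sublist _⊆_

⊑-refl : ∀ {L} → L ⊑ L
⊑-refl = Sublist.refl ⊆-refl

⊑-trans : ∀ {K L N} → K ⊑ L → L ⊑ N → K ⊑ N
⊑-trans = Sublist.trans ⊆-trans

data Stack : ℕ → List (List ℕ) → Set where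
  []  : Stack 0 []
  _∷_ : ∀ {n w L} → length w ≡ suc n → Stack n L → Stack (suc n) (w ∷ L)

-- Passing between sets and stacks of levels

flat : List (List ℕ) → List ℕ
flat []      = []
flat (w ∷ L) = flat L ++ w

levels : List ℕ → ℕ → List (List ℕ)
levels X zero    = []
levels X (suc n) = level X n ∷ levels X n

length-flat : ∀ {n L} → Stack n L → length (flat L) ≡ T n
length-flat []                = refl
length-flat (_∷_ {w = w} {L} e s) = trans (length-++ (flat L)) (cong₂ _+_ (length-flat s) e)

-- Level sizes are prescribed, so the parts before the last level are equally long and both
-- concatenations split at the same place.
flat-injective : ∀ {n K L} → Stack n K → Stack n L → flat K ≡ flat L → K ≡ L
flat-injective []       []       _  = refl
flat-injective (_ ∷ s)  (_ ∷ t)  eq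
  with p , q ← ++-injective _ (trans (length-flat s) (sym (length-flat t))) eq
  = cong₂ _∷_ q (flat-injective s t p)

T-mono : ∀ {m n} → m ≤ n → T m ≤ T n
T-mono z≤n     = z≤n
T-mono (s≤s p) = +-mono-≤ (T-mono p) (s≤s p)

length-level : ∀ {n} X i → i < n → length X ≡ T n → length (level X i) ≡ suc i
length-level {n} X i i<n e = begin
  length (level X i)             ≡⟨ length-take (suc i) (drop (T i) X) ⟩
  suc i ⊓ length (drop (T i) X)  ≡⟨ m≤n⇒m⊓n≡m (subst (suc i ≤_) (sym (length-drop (T i) X)) big) ⟩
  suc i                          ∎
  where
  open ≡-Reasoning
  big : suc i ≤ length X ∸ T i
  big = m+n≤o⇒m≤o∸n (suc i) (subst₂ _≤_ (+-comm (T i) (suc i)) (sym e) (T-mono i<n))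

levels-stack : ∀ {n} X m → m ≤ n → length X ≡ T n → Stack m (levels X m)
levels-stack X zero    _   _ = []
levels-stack X (suc m) m<n e = length-level X m m<n e ∷ levels-stack X m (<⇒≤ m<n) e

flat-levels-take : ∀ X n → flat (levels X n) ≡ take (T n) X
flat-levels-take X zero    = refl
flat-levels-take X (suc n) = trans (cong (_++ level X n) (flat-levels-take X n)) (take-+ (T n) (suc n) X)

flat-levels : ∀ X n → length X ≡ T n → flat (levels X n) ≡ X
flat-levels X n e = trans (flat-levels-take X n) (take-all (T n) X (≤-reflexive e))

levels-flat : ∀ {n L} → Stack n L → levels (flat L) n ≡ L
levels-flat {n} {L} s = flat-injective (levels-stack (flat L) n ≤-refl (length-flat s)) s
  (flat-levels (flat L) n (length-flat s))

flat-mono : ∀ {K L} → K ⊑ L → flat K ⊆ flat L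
flat-mono []                  = []
flat-mono (w ∷ʳ s)            = ⊆-++⁺ʳ w (flat-mono s)
flat-mono (p ∷ s)             = ⊆-++⁺ (flat-mono s) p

-- The order on triangles as the order on stacks

level-⊆ : ∀ X i → level X i ⊆ X
level-⊆ X i = ⊆-trans (take-⊆ (suc i) _) (drop-⊆ (T i) X)

level-< : ∀ {X i j x y} → Sorted X → i < j → x ∈ level X i → y ∈ level X j → x < y
-- `T i + suc i` is `T (suc i)`, the position where level `i` ends, and it is at most `T j`.
level-< {X} {i} {j} s i<j x∈ y∈ = take-before-drop (T i + suc i) (T j) s (T-mono i<j)
  (subst (_ ∈_) (take-+ (T i) (suc i) X) (∈-++⁺ʳ (take (T i) X) x∈))
  (lookup (take-⊆ (suc j) _) y∈)

level-nonempty : ∀ {n} X i → i < n → length X ≡ T n → ∃ λ x → x ∈ level X i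
level-nonempty X i i<n e with level X i | length-level X i i<n e
... | x ∷ _ | _ = x , here refl

-- The level map in `Le` is only assumed injective, yet levels are consecutive blocks, so it must
-- increase. Hence both stacks can be scanned from the last level down.
Le⇒⊑ : ∀ {k n X Y} → Sorted X → length X ≡ T k → Sorted Y → Le k n X Y → levels X k ⊑ levels Y n
Le⇒⊑ {k} {n} {X} {Y} sX eX sY (_ , f , inj , incl) =
  go k n ≤-refl F (λ p → toℕ<n _) (λ p p′ e → fromℕ<-inj p p′ (inj (toℕ-injective e)))
    (λ {i} p x x∈ → incl (fromℕ< p) x (subst (λ i → x ∈ level X i) (sym (toℕ-fromℕ< p)) x∈))
  where
  F : ∀ {i} → .(i < k) → ℕ
  F p = toℕ (f (fromℕ< p))

  fromℕ<-inj : ∀ {i j} (p : i < k) (q : j < k) → fromℕ< p ≡ fromℕ< q → i ≡ j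
  fromℕ<-inj p q e = trans (sym (toℕ-fromℕ< p)) (trans (cong toℕ e) (toℕ-fromℕ< q))

  -- `G` is the level map on the levels still to be placed; its bound is irrelevant, so its value
  -- does not depend on the proof of `i < a`.
  go : ∀ a b → a ≤ k → (G : ∀ {i} → .(i < a) → ℕ) →
    (∀ {i} (p : i < a) → G p < b) →
    (∀ {i j} (p : i < a) (q : j < a) → G p ≡ G q → i ≡ j) →
    (∀ {i} (p : i < a) x → x ∈ level X i → x ∈ level Y (G p)) →
    levels X a ⊑ levels Y b
  go zero    b       _   G bd in′ inc = minimum _
  go (suc a) zero    _   G bd in′ inc with () ← bd (n<1+n a)
  go (suc a) (suc b) a<k G bd in′ inc with G (n<1+n a) ≟ b
  ... | yes top =
    sorted-∈⇒⊆ (AllPairs-resp-⊆ (level-⊆ X a) sX) (AllPairs-resp-⊆ (level-⊆ Y b) sY)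
      (λ x x∈ → subst (λ i → x ∈ level Y i) top (inc (n<1+n a) x x∈))
    -- By injectivity no lower level of `X` also goes to the top level of `Y`, so the bound drops to
    -- `b`.
    ∷ go a b (<⇒≤ a<k) (λ p → G (m<n⇒m<1+n p))
        (λ p → ≤∧≢⇒< (s≤s⁻¹ (bd (m<n⇒m<1+n p)))
          (λ e → <-irrefl (in′ (m<n⇒m<1+n p) (n<1+n a) (trans e (sym top))) p))
        (λ p q → in′ (m<n⇒m<1+n p) (m<n⇒m<1+n q))
        (λ p → inc (m<n⇒m<1+n p))
  ... | no ¬top = level Y b ∷ʳ go (suc a) b a<k G (λ p → ≤∧≢⇒< (s≤s⁻¹ (bd p)) (missed p)) in′ inc
    where
    -- Were a lower level of X sent to the top level of Y, the top level of X would have to lie above it.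
    missed : ∀ {i} (p : i < suc a) → G p ≢ b
    missed {i} p e with i ≟ a
    ... | yes refl = ¬top e
    ... | no i≢a =
      let x , x∈ = level-nonempty X i (≤-trans p a<k) eX
          y , y∈ = level-nonempty X a a<k eX
      in <-asym (level-< sX (≤∧≢⇒< (s≤s⁻¹ p) i≢a) x∈ y∈)
           (level-< sY (≤∧≢⇒< (s≤s⁻¹ (bd (n<1+n a))) ¬top) (inc (n<1+n a) y y∈)
             (subst (λ i → x ∈ level Y i) e (inc p x x∈)))

-- Strict increase yields the injectivity that `Le` asks for, and it survives a new last level,
-- whose image `m` exceeds all earlier ones.
⊑⇒increasing : ∀ {X Y} n m → levels X n ⊑ levels Y m → ∃ λ (f : ℕ → ℕ) →
  (∀ {i} → i < n → f i < m) × (∀ {i j} → i < j → j < n → f i < f j) ×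
  (∀ {i} → i < n → level X i ⊆ level Y (f i))
⊑⇒increasing zero    m       s = (λ i → i) , (λ ()) , (λ _ ()) , (λ ())
⊑⇒increasing (suc n) (suc m) (_ ∷ʳ s) =
  let f , bd , mono , inc = ⊑⇒increasing (suc n) m s in f , m<n⇒m<1+n ∘ bd , mono , inc
⊑⇒increasing {X} {Y} (suc n) (suc m) (p ∷ s) = g , bd′ , mono′ , inc′
  where
  IH = ⊑⇒increasing n m s
  f = proj₁ IH
  bd = proj₁ (proj₂ IH)
  mono = proj₁ (proj₂ (proj₂ IH))
  inc = proj₂ (proj₂ (proj₂ IH))
  g : ℕ → ℕ
  g i with i ≟ n
  ... | yes _ = m
  ... | no  _ = f i
  bd′ : ∀ {i} → i < suc n → g i < suc m
  bd′ {i} i< with i ≟ n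
  ... | yes _ = n<1+n m
  ... | no i≢n = m<n⇒m<1+n (bd (≤∧≢⇒< (s≤s⁻¹ i<) i≢n))
  mono′ : ∀ {i j} → i < j → j < suc n → g i < g j
  mono′ {i} {j} i<j j< with i ≟ n | j ≟ n
  ... | yes refl | _        = contradiction (<-≤-trans i<j (s≤s⁻¹ j<)) (<-irrefl refl)
  ... | no i≢n   | yes refl = bd i<j
  ... | no i≢n   | no j≢n   = mono i<j (≤∧≢⇒< (s≤s⁻¹ j<) j≢n)
  inc′ : ∀ {i} → i < suc n → level X i ⊆ level Y (g i)
  inc′ {i} i< with i ≟ n
  ... | yes refl = p
  ... | no i≢n   = inc (≤∧≢⇒< (s≤s⁻¹ i<) i≢n)

⊑⇒Le : ∀ {n m X Y} → length X ≡ T n → length Y ≡ T m → levels X n ⊑ levels Y m → Le n m X Y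
⊑⇒Le {n} {m} {X} {Y} eX eY s =
  (λ x x∈ → subst (x ∈_) (flat-levels Y m eY)
    (lookup (flat-mono s) (subst (x ∈_) (sym (flat-levels X n eX)) x∈))) ,
  (λ i → fromℕ< (bd (toℕ<n i))) , inj ,
  λ i x x∈ → subst (λ j → x ∈ level Y j) (sym (toℕ-fromℕ< (bd (toℕ<n i)))) (lookup (inc (toℕ<n i)) x∈)
  where
  IH = ⊑⇒increasing {X} {Y} n m s
  f = proj₁ IH
  bd = proj₁ (proj₂ IH)
  mono = proj₁ (proj₂ (proj₂ IH))
  inc = proj₂ (proj₂ (proj₂ IH))
  inj : ∀ {i j : Fin n} → fromℕ< (bd (toℕ<n i)) ≡ fromℕ< (bd (toℕ<n j)) → i ≡ j
  inj {i} {j} e with <-cmp (toℕ i) (toℕ j) | trans (sym (toℕ-fromℕ< (bd (toℕ<n i)))) (trans (cong toℕ e) (toℕ-fromℕ< (bd (toℕ<n j))))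
  ... | tri< i<j _ _ | fe = contradiction (mono i<j (toℕ<n j)) (<-irrefl fe)
  ... | tri≈ _ i≡j _ | _  = toℕ-injective i≡j
  ... | tri> _ _ j<i | fe = contradiction (mono j<i (toℕ<n i)) (<-irrefl (sym fe))

-- Monochromatic stacks and won games

MonoStack : Bool → ℕ → ℕ → List (List ℕ) → (List (List ℕ) → Bool) → Set
MonoStack b p k L c =
  ∃ λ Z → Stack p Z × Z ⊑ L × (∀ W → Stack k W → W ⊑ Z → c W ≡ b)

flat-Tri : ∀ {n L} → Stack n L → Sorted (flat L) → Tri n (flat L)
flat-Tri s o = AllPairs⇒Linked o , length-flat s

WinsWith⇒MonoStack : ∀ {b p k m L} → Stack m L → Sorted (flat L) → ∀ c →
  WinsWith b p k m (flat L) (λ X → c (levels X k)) → MonoStack b p k L c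
WinsWith⇒MonoStack {b} {p} {k} sL oL c (Z , (lZ , eZ) , le , mono) =
  levels Z p , levels-stack Z p ≤-refl eZ , subst (levels Z p ⊑_) (levels-flat sL) (Le⇒⊑ oZ eZ oL le) , mono′
  where
  oZ = Linked⇒AllPairs <-trans lZ
  mono′ : ∀ W → Stack k W → W ⊑ levels Z p → c W ≡ b
  mono′ W sW W⊑ = trans (cong c (sym (levels-flat sW)))
    (mono (flat W) (flat-Tri sW (AllPairs-resp-⊆ (subst (flat W ⊆_) (flat-levels Z p eZ) (flat-mono W⊑)) oZ))
      (⊑⇒Le (length-flat sW) eZ (subst (_⊑ levels Z p) (sym (levels-flat sW)) W⊑)))

MonoStack⇒WinsWith : ∀ {b p k m B} → Tri m B → ∀ c →
  MonoStack b p k (levels B m) (λ L → c (flat L)) → WinsWith b p k m B c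
MonoStack⇒WinsWith {b} {p} {k} {m} {B} (lB , eB) c (Z , sZ , Z⊑ , mono) =
  flat Z , flat-Tri sZ oZ , ⊑⇒Le (length-flat sZ) eB (subst (_⊑ levels B m) (sym (levels-flat sZ)) Z⊑) , mono′
  where
  oZ : Sorted (flat Z)
  oZ = AllPairs-resp-⊆ (subst (flat Z ⊆_) (flat-levels B m eB) (flat-mono Z⊑)) (Linked⇒AllPairs <-trans lB)
  mono′ : ∀ W → Tri k W → Le k p W (flat Z) → c W ≡ b
  mono′ W (lW , eW) le = trans (cong c (sym (flat-levels W k eW)))
    (mono (levels W k) (levels-stack W k ≤-refl eW)
      (subst (levels W k ⊑_) (levels-flat sZ) (Le⇒⊑ (Linked⇒AllPairs <-trans lW) eW oZ le)))

NoDraw⇒MonoStack : ∀ {p k m L} → NoDraw p p k m → Stack m L → Sorted (flat L) →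
  ∀ c → ∃ λ b → MonoStack b p k L c
NoDraw⇒MonoStack {k = k} {L = L} nd sL oL c
  with nd (flat L) (flat-Tri sL oL) (λ X → c (levels X k))
... | inj₁ w = true  , WinsWith⇒MonoStack sL oL c w
... | inj₂ w = false , WinsWith⇒MonoStack sL oL c w

-- Comparing and shortening stacks

length-stack : ∀ {n L} → Stack n L → length L ≡ n
length-stack []      = refl
length-stack (_ ∷ s) = cong suc (length-stack s)

stack-⊑⇒≤ : ∀ {m n K L} → Stack m K → Stack n L → K ⊑ L → m ≤ n
stack-⊑⇒≤ s t K⊑L = subst₂ _≤_ (length-stack s) (length-stack t) (Sublist.length-mono-≤ K⊑L)

⊆-length-≡ : ∀ {A : Set} {xs ys : List A} → length xs ≡ length ys → xs ⊆ ys → xs ≡ ys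
⊆-length-≡ e s = Pointwise-≡⇒≡ (Sublist.toPointwise e s)

-- Skipping a level would embed a stack in one with fewer levels. So level is matched with level,
-- and a sublist of full length is everything.
stack-⊑-≡ : ∀ {n K L} → Stack n K → Stack n L → K ⊑ L → K ≡ L
stack-⊑-≡ []      []      _       = refl
stack-⊑-≡ s@(_ ∷ _) (_ ∷ t) (_ ∷ʳ p) = contradiction (stack-⊑⇒≤ s t p) (<-irrefl refl)
stack-⊑-≡ (e ∷ s) (e′ ∷ t) (p ∷ q) = cong₂ _∷_ (⊆-length-≡ (trans e (sym e′)) p) (stack-⊑-≡ s t q)

-- Only last levels are discarded: the others keep their positions and hence the required sizes.
trim : ∀ {m n L} → n ≤ m → Stack m L → ∃ λ K → Stack n K × K ⊑ L
trim {n = n} n≤m s with m≤n⇒m<n∨m≡n n≤m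
... | inj₂ refl = _ , s , ⊑-refl
trim n≤m (e ∷ s) | inj₁ n<m =
  let K , sK , K⊑ = trim (s≤s⁻¹ n<m) s in K , sK , _ ∷ʳ K⊑

-- Ramsey properties for lists

pick : ∀ {A : Set} (xs : List A) → Subset (length xs) → List A
pick []       []            = []
pick (x ∷ xs) (inside  ∷ S) = x ∷ pick xs S
pick (x ∷ xs) (outside ∷ S) = pick xs S

pick-⊆ : ∀ {A : Set} (xs : List A) S → pick xs S ⊆ xs
pick-⊆ []       []            = []
pick-⊆ (x ∷ xs) (inside  ∷ S) = refl ∷ pick-⊆ xs S
pick-⊆ (x ∷ xs) (outside ∷ S) = x ∷ʳ pick-⊆ xs S

length-pick : ∀ {A : Set} (xs : List A) S → length (pick xs S) ≡ ∣ S ∣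
length-pick []       []            = refl
length-pick (x ∷ xs) (inside  ∷ S) = cong suc (length-pick xs S)
length-pick (x ∷ xs) (outside ∷ S) = length-pick xs S

-- The Ramsey property speaks of sets of positions; a sublist must be traced back to such a set
-- before the property applies to it.
⊆-pick : ∀ {A : Set} (xs : List A) S {u} → u ⊆ pick xs S → ∃ λ U → U ⊆ˢ S × pick xs U ≡ u
⊆-pick []       []            []         = [] , (λ ()) , refl
⊆-pick (x ∷ xs) (inside  ∷ S) (_ ∷ʳ p)   = let U , U⊆ , e = ⊆-pick xs S p in outside ∷ U , out⊆ U⊆ , e
⊆-pick (x ∷ xs) (inside  ∷ S) (refl ∷ p) = let U , U⊆ , e = ⊆-pick xs S p in inside ∷ U , in⊆in U⊆ , cong (x ∷_) e
⊆-pick (x ∷ xs) (outside ∷ S) p          = let U , U⊆ , e = ⊆-pick xs S p in outside ∷ U , out⊆ U⊆ , e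

Homogeneous : ℕ → List ℕ → (List ℕ → Bool) → Set
Homogeneous k s c = ∃ λ b → ∀ {u} → u ⊆ s → length u ≡ k → c u ≡ b

RamseyProp⇒Homogeneous : ∀ {n k} z → RamseyProp n k (length z) → ∀ c →
  ∃ λ s → s ⊆ z × length s ≡ n × Homogeneous k s c
RamseyProp⇒Homogeneous {n} {k} z ramsey c =
  let S , ∣S∣ , b , mono = ramsey (c ∘ pick z)
  in pick z S , pick-⊆ z S , trans (length-pick z S) ∣S∣ , b , λ u⊆ e →
    let U , U⊆S , U≡u = ⊆-pick z S u⊆
    in trans (cong c (sym U≡u)) (mono U U⊆S (trans (sym (length-pick z U)) (trans (cong length U≡u) e)))

RamseyProp⇒≤ : ∀ {n k N} → RamseyProp n k N → n ≤ N
RamseyProp⇒≤ ramsey = let S , ∣S∣ , _ = ramsey (λ _ → true) in subst (_≤ _) ∣S∣ (∣p∣≤n S)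

subset-of-size : ∀ {k n} → k ≤ n → ∃ λ (U : Subset n) → ∣ U ∣ ≡ k
subset-of-size {n = zero}  z≤n = [] , refl
subset-of-size {n = suc n} z≤n = let U , e = subset-of-size z≤n in outside ∷ U , e
subset-of-size (s≤s p)         = let U , e = subset-of-size p in inside ∷ U , cong suc e

-- Colour a set by whether it contains the first point.
¬RamseyProp-diagonal : ∀ {n k} → suc k < n → ¬ RamseyProp n (suc k) n
¬RamseyProp-diagonal {suc n} {k} (s≤s k<n) ramsey
  with S , ∣S∣ , b , mono ← ramsey head
  with refl ← ∣p∣≡n⇒p≡⊤ {p = S} ∣S∣
  with U , eU ← subset-of-size {k} {n} (<⇒≤ k<n)
  with V , eV ← subset-of-size {suc k} {n} k<n
  with () ← trans (mono (inside ∷ U) ⊆⊤ (cong suc eU)) (sym (mono (outside ∷ V) ⊆⊤ eV))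

-- Counting substacks

choose : ℕ → List ℕ → List (List ℕ)
choose zero    _        = [] ∷ []
choose (suc k) []       = []
choose (suc k) (x ∷ xs) = map (x ∷_) (choose k xs) ++ choose (suc k) xs

length-choose : ∀ k xs → length (choose k xs) ≡ length xs C k
length-choose zero    xs       = refl
length-choose (suc k) []       = refl
length-choose (suc k) (x ∷ xs) = begin
  length (map (x ∷_) (choose k xs) ++ choose (suc k) xs)
    ≡⟨ length-++ (map (x ∷_) (choose k xs)) ⟩
  length (map (x ∷_) (choose k xs)) + length (choose (suc k) xs)
    ≡⟨ cong₂ _+_ (trans (length-map (x ∷_) (choose k xs)) (length-choose k xs)) (length-choose (suc k) xs) ⟩
  length xs C k + length xs C suc k
    ≡⟨ nCk+nC[k+1]≡[n+1]C[k+1] (length xs) k ⟩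
  suc (length xs) C suc k ∎
  where open ≡-Reasoning

∈-choose : ∀ {u xs} → u ⊆ xs → u ∈ choose (length u) xs
∈-choose {[]}    _          = here refl
∈-choose {_ ∷ _} (_ ∷ʳ p)   = ∈-++⁺ʳ _ (∈-choose p)
∈-choose {_ ∷ _} (refl ∷ p) = ∈-++⁺ˡ (∈-map⁺ _ (∈-choose p))

substacks : ℕ → List (List ℕ) → List (List (List ℕ))
substacks zero    _       = [] ∷ []
substacks (suc k) []      = []
substacks (suc k) (z ∷ L) = substacks (suc k) L ++ cartesianProductWith _∷_ (choose (suc k) z) (substacks k L)

∈-substacks : ∀ {k W L} → Stack k W → W ⊑ L → W ∈ substacks k L
∈-substacks []          _        = here refl
∈-substacks s@(_ ∷ _)   (_ ∷ʳ q) = ∈-++⁺ˡ (∈-substacks s q)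
∈-substacks {suc k} {w ∷ _} {z ∷ L} (e ∷ s) (p ∷ q) = ∈-++⁺ʳ (substacks (suc k) L)
  (∈-cartesianProductWith⁺ _∷_ (subst (λ i → w ∈ choose i z) e (∈-choose p)) (∈-substacks s q))

length-cartesianProductWith : ∀ {A B C : Set} (f : A → B → C) xs ys →
  length (cartesianProductWith f xs ys) ≡ length xs * length ys
length-cartesianProductWith f []       ys = refl
length-cartesianProductWith f (x ∷ xs) ys =
  trans (length-++ (map (f x) ys)) (cong₂ _+_ (length-map (f x) ys) (length-cartesianProductWith f xs ys))

brack-diagonal : ∀ n → brack n n ≡ 1
brack-diagonal zero    = refl
brack-diagonal (suc n) rewrite dec-true (n ≟ n) refl = refl

brack-< : ∀ {n k} → n < k → brack n k ≡ 0
brack-< {zero}  {suc k} _ = refl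
brack-< {suc n} {suc k} (s≤s n<k)
  rewrite dec-false (n ≟ k) (<⇒≢ n<k) | brack-< (m<n⇒m<1+n n<k) | brack-< n<k = *-zeroʳ (suc n C suc k)

-- On the diagonal the recurrence reads 1 = 0 + 1 · 1, so it holds without exception and later
-- inductions can use it uniformly.
brack-suc : ∀ n k → brack (suc n) (suc k) ≡ brack n (suc k) + (suc n C suc k) * brack n k
brack-suc n k with n ≟ k
... | yes refl rewrite dec-true (n ≟ n) refl | brack-< (n<1+n n) | brack-diagonal n | nCn≡1 (suc n) = refl
... | no n≢k   rewrite dec-false (n ≟ k) n≢k = refl

-- The two summands of the recurrence count the substacks that skip the last level and those that
-- use it; in the latter case the binomial coefficient counts the choices inside that level.
length-substacks : ∀ {n L} k → Stack n L → length (substacks k L) ≡ brack n k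
length-substacks {zero}  zero    s  = refl
length-substacks {suc n} zero    s  = refl
length-substacks (suc k) []         = refl
length-substacks {suc n} {z ∷ L} (suc k) (e ∷ s) = begin
  length (substacks (suc k) L ++ cartesianProductWith _∷_ (choose (suc k) z) (substacks k L))
    ≡⟨ length-++ (substacks (suc k) L) ⟩
  length (substacks (suc k) L) + length (cartesianProductWith _∷_ (choose (suc k) z) (substacks k L))
    ≡⟨ cong₂ _+_ (length-substacks (suc k) s) (length-cartesianProductWith _∷_ (choose (suc k) z) (substacks k L)) ⟩
  brack n (suc k) + length (choose (suc k) z) * length (substacks k L)
    ≡⟨ cong (brack n (suc k) +_) (cong₂ _*_ (trans (length-choose (suc k) z) (cong (_C suc k) e)) (length-substacks k s)) ⟩
  brack n (suc k) + (suc n C suc k) * brack n k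
    ≡⟨ brack-suc n k ⟨
  brack (suc n) (suc k) ∎
  where open ≡-Reasoning

C-positive : ∀ {n k} → k ≤ n → 1 ≤ n C k
C-positive {n}     {zero}  _       = ≤-refl
C-positive {suc n} {suc k} (s≤s p) =
  subst (1 ≤_) (nCk+nC[k+1]≡[n+1]C[k+1] n k) (≤-trans (C-positive p) (m≤m+n _ _))

brack-positive : ∀ {n k} → k ≤ n → 1 ≤ brack n k
brack-positive {zero}  {zero}  _       = ≤-refl
brack-positive {suc n} {zero}  _       = ≤-refl
brack-positive {suc n} {suc k} (s≤s p) rewrite brack-suc n k =
  ≤-trans (*-mono-≤ (C-positive (s≤s p)) (brack-positive p)) (m≤n+m _ (brack n (suc k)))

-- From 1 on the diagonal, the bracket gains at least one whenever `n` grows by one, as the added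
-- product is positive. This later makes the iterated Ramsey number exceed `r`.
brack-growth : ∀ {n k} → suc k ≤ n → n < brack n (suc k) + suc k
brack-growth {suc n} {k} (s≤s k≤n) with m≤n⇒m<n∨m≡n k≤n
... | inj₂ refl rewrite dec-true (k ≟ k) refl = ≤-refl
... | inj₁ k<n  rewrite brack-suc n k = begin
  2 + n                                            ≤⟨ s≤s (brack-growth k<n) ⟩
  1 + (b + suc k)                                  ≤⟨ +-monoˡ-≤ (b + suc k) (*-mono-≤ (C-positive (s≤s k≤n)) (brack-positive k≤n)) ⟩
  a + (b + suc k)                                  ≡⟨ +-assoc a b (suc k) ⟨
  a + b + suc k                                    ≡⟨ cong (_+ suc k) (+-comm a b) ⟩
  b + a + suc k                                    ∎
  where
  open ≤-Reasoning
  a = (suc n C suc k) * brack n k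
  b = brack n (suc k)

-- The colour of a k-stack inside the given stack is read off from any one element of its top level.
data TopDetermined (k : ℕ) (c : List (List ℕ) → Bool) : List (List ℕ) → Set where
  []  : TopDetermined k c []
  _∷_ : ∀ {z L} →
    (∃ λ (g : ℕ → Bool) → ∀ {w W} → w ⊆ z → W ⊑ L → Stack k (w ∷ W) → ∃ λ x → x ∈ w × c (w ∷ W) ≡ g x) →
    TopDetermined k c L → TopDetermined k c (z ∷ L)

-- First cases of top-determined colourings

nonempty : ∀ {n} {w : List ℕ} → length w ≡ suc n → ∃ λ x → x ∈ w
nonempty {w = x ∷ _} _ = x , here refl

topDetermined-1 : ∀ c L → TopDetermined 1 c L
topDetermined-1 c []      = []
topDetermined-1 c (z ∷ L) = ((λ x → c ((x ∷ []) ∷ [])) , top) ∷ topDetermined-1 c L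
  where
  top : ∀ {w W} → w ⊆ z → W ⊑ L → Stack 1 (w ∷ W) → ∃ λ x → x ∈ w × c (w ∷ W) ≡ c ((x ∷ []) ∷ [])
  top {x ∷ []} _ _ (_ ∷ []) = x , here refl , refl

-- At most one `k`-stack lies below, namely the whole stack when `n = k`, so a constant function can
-- predict its colour.
topDetermined-short : ∀ {n k L} c → n ≤ k → Stack n L → TopDetermined k c L
topDetermined-short c n≤k [] = []
topDetermined-short {k = k} c n≤k s@(_∷_ {w = z} {L = L} e t) =
  ((λ _ → c (z ∷ L)) , top) ∷ topDetermined-short c (<⇒≤ n≤k) t
  where
  top : ∀ {w W} → w ⊆ z → W ⊑ L → Stack k (w ∷ W) → ∃ λ x → x ∈ w × c (w ∷ W) ≡ c (z ∷ L)
  top p q s′@(e′ ∷ _) with refl ← ≤-antisym n≤k (stack-⊑⇒≤ s′ s (p ∷ q)) =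
    let x , x∈ = nonempty e′ in x , x∈ , cong c (stack-⊑-≡ s′ s (p ∷ q))

-- Greedy choice of monochromatic stacks

-- Pigeonhole: each entry lowers the quota of its own colour, and meeting a colour with quota zero
-- supplies its last missing element.
split-colours : ∀ (g : ℕ → Bool) p q z → p + q < length z →
  (∃ λ u → u ⊆ z × length u ≡ suc p × All (λ x → g x ≡ true) u) ⊎
  (∃ λ u → u ⊆ z × length u ≡ suc q × All (λ x → g x ≡ false) u)
split-colours g p q (x ∷ z) (s≤s p+q≤) with g x in eq
split-colours g zero q (x ∷ z) (s≤s p+q≤) | true = inj₁ (x ∷ [] , refl ∷ minimum z , refl , eq ∷ [])
split-colours g (suc p) q (x ∷ z) (s≤s p+q≤) | true with split-colours g p q z p+q≤
... | inj₁ (u , u⊆ , e , a) = inj₁ (x ∷ u , refl ∷ u⊆ , cong suc e , eq ∷ a)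
... | inj₂ (u , u⊆ , e , a) = inj₂ (u , x ∷ʳ u⊆ , e , a)
split-colours g p zero (x ∷ z) (s≤s p+q≤) | false = inj₂ (x ∷ [] , refl ∷ minimum z , refl , eq ∷ [])
split-colours g p (suc q) (x ∷ z) (s≤s p+q≤) | false
  with split-colours g p q z (subst (_≤ length z) (+-suc p q) p+q≤)
... | inj₁ (u , u⊆ , e , a) = inj₁ (u , x ∷ʳ u⊆ , e , a)
... | inj₂ (u , u⊆ , e , a) = inj₂ (x ∷ u , refl ∷ u⊆ , cong suc e , eq ∷ a)

mono-⊑ : ∀ {b p k K L c} → K ⊑ L → MonoStack b p k K c → MonoStack b p k L c
mono-⊑ K⊑L (Z , sZ , Z⊑ , mono) = Z , sZ , ⊑-trans Z⊑ K⊑L , mono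

-- A `k`-stack that skips the new level is settled by `mono`; any other has its top level inside
-- `u`, where `g` is constantly `b`.
mono-extend : ∀ {b p k z L c} (g : ℕ → Bool) →
  (∀ {w W} → w ⊆ z → W ⊑ L → Stack k (w ∷ W) → ∃ λ x → x ∈ w × c (w ∷ W) ≡ g x) →
  (∃ λ u → u ⊆ z × length u ≡ suc p × All (λ x → g x ≡ b) u) →
  MonoStack b p k L c → MonoStack b (suc p) k (z ∷ L) c
mono-extend {b} {k = k} {c = c} g top (u , u⊆ , e , a) (Z , sZ , Z⊑ , mono) =
  u ∷ Z , e ∷ sZ , u⊆ ∷ Z⊑ , mono′
  where
  mono′ : ∀ W → Stack k W → W ⊑ u ∷ Z → c W ≡ b
  mono′ W       s (_ ∷ʳ q) = mono W s q
  mono′ (w ∷ W) s (p ∷ q)  =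
    let x , x∈ , eq = top (⊆-trans p u⊆) (⊑-trans q Z⊑) s in trans eq (All.lookup a (lookup p x∈))

-- A new level of size N > p + q has p + 1 elements of colour true or q + 1 of colour false,
-- so one of the two monochromatic stacks can be extended whenever p + q < N.
mono-pair : ∀ {N k L c} → Stack N L → TopDetermined (suc k) c L →
  ∃ λ p → ∃ λ q → N ≤ p + q × MonoStack true p (suc k) L c × MonoStack false q (suc k) L c
mono-pair {k = k} {c = c} [] [] = 0 , 0 , z≤n , empty , empty
  where
  empty : ∀ {b} → MonoStack b 0 (suc k) [] c
  empty = [] , [] , [] , λ { W () [] }
mono-pair {suc N} (_∷_ {w = z} e s) ((g , top) ∷ t)
  with p , q , N≤ , red , blue ← mono-pair s t
  with p + q <? suc N
... | no ≮ = p , q , ≮⇒≥ ≮ , mono-⊑ (_ ∷ʳ ⊑-refl) red , mono-⊑ (_ ∷ʳ ⊑-refl) blue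
... | yes p+q< with split-colours g p q z (subst (p + q <_) (sym e) p+q<)
... | inj₁ u = suc p , q , s≤s N≤ , mono-extend g top u red , mono-⊑ (_ ∷ʳ ⊑-refl) blue
... | inj₂ u = p , suc q , subst (suc N ≤_) (sym (+-suc p q)) (s≤s N≤) , mono-⊑ (_ ∷ʳ ⊑-refl) red , mono-extend g top u blue

mono-trim : ∀ {b p n k L c} → n ≤ p → MonoStack b p k L c → MonoStack b n k L c
mono-trim n≤p (Z , sZ , Z⊑ , mono) =
  let K , sK , K⊑ = trim n≤p sZ in K , sK , ⊑-trans K⊑ Z⊑ , λ W s q → mono W s (⊑-trans q K⊑)

n≤2n∸1 : ∀ n → n ≤ 2 * n ∸ 1
n≤2n∸1 zero    = z≤n
n≤2n∸1 (suc n) rewrite +-identityʳ n | +-suc n n = s≤s (m≤m+n n n)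

-- For positive `n`, if both numbers were below `n`, their sum would be at most `2n-2`.
2n∸1≤p+q⇒ : ∀ n {p q} → 2 * n ∸ 1 ≤ p + q → n ≤ p ⊎ n ≤ q
2n∸1≤p+q⇒ zero    _  = inj₁ z≤n
2n∸1≤p+q⇒ (suc n) {p} {q} le with suc n ≤? p | suc n ≤? q
... | yes n<p | _       = inj₁ n<p
... | no  _   | yes n<q = inj₂ n<q
... | no  n≮p | no  n≮q rewrite +-identityʳ n | +-suc n n =
  contradiction (≤-trans le (+-mono-≤ (≮⇒≥ n≮p) (≮⇒≥ n≮q))) (<-irrefl refl)

-- Stepping up through iterated Ramsey numbers

module _ (r1 R : ℕ → ℕ → ℕ)
  (hr1 : ∀ n k → k ≤ n → IsR1 n n k (r1 n k))
  (hR : ∀ n k → IsRamsey n k (R n k)) where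

  -- Every iteration gains at least one: `¬RamseyProp-diagonal` excludes a fixed point, and the
  -- iterates stay above `suc k`, so it keeps applying.
  Riter-growth : ∀ {n k} l → suc k < n → n + l ≤ Riter R l n (suc k)
  Riter-growth {n} zero    _   = ≤-reflexive (+-identityʳ n)
  Riter-growth {n} {k} (suc l) k<n = begin
    n + suc l         ≡⟨ +-suc n l ⟩
    suc (n + l)       ≤⟨ s≤s IH ⟩
    suc m             ≤⟨ ≤∧≢⇒< (RamseyProp⇒≤ ramsey) m≢ ⟩
    R m (suc k)       ∎
    where
    open ≤-Reasoning
    m = Riter R l n (suc k)
    IH = Riter-growth l k<n
    ramsey = proj₁ (hR m (suc k))
    m≢ : m ≢ R m (suc k)
    m≢ e = ¬RamseyProp-diagonal (<-≤-trans k<n (m+n≤o⇒m≤o n IH)) (subst (RamseyProp m (suc k)) (sym e) ramsey)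

  -- Each colouring spends one iteration. Homogeneity passes to sublists, so later thinning does not
  -- spoil it.
  Riter⇒Homogeneous : ∀ {n k} (cs : List (List ℕ → Bool)) z → length z ≡ Riter R (length cs) n k →
    ∃ λ s → s ⊆ z × length s ≡ n × All (Homogeneous k s) cs
  Riter⇒Homogeneous []       z e = z , ⊆-refl , e , []
  Riter⇒Homogeneous {n} {k} (c ∷ cs) z e =
    let z′ , z′⊆ , e′ , b , hom = RamseyProp⇒Homogeneous z (subst (RamseyProp _ k) (sym e) (proj₁ (hR _ k))) c
        s , s⊆ , es , homs = Riter⇒Homogeneous cs z′ e′
    in s , ⊆-trans s⊆ z′⊆ , es , (b , λ u⊆ → hom (⊆-trans u⊆ s⊆)) ∷ homs

  M-diagonal : ∀ j → M r1 R (2 + j) (2 + j) ≡ 2 + j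
  M-diagonal j rewrite dec-true (j ≟ j) refl = refl

  iterations : ℕ → ℕ → ℕ
  iterations N j = brack (r1 (M r1 R N (2 + j)) (suc j)) (suc j)

  M-suc : ∀ {N} j → 2 + j ≤ N → M r1 R (suc N) (2 + j) ≡ Riter R (iterations N j) (suc N) (2 + j)
  M-suc {suc N} j k≤N@(s≤s p)
    rewrite dec-false (N ≟ j) (≢-sym (<⇒≢ p)) | dec-true (2 + j ≤? suc N) k≤N = refl

  M-≥ : ∀ {N k} → suc k ≤ N → N ≤ M r1 R N (suc k)
  M-≥ {suc N} {zero}  _ = ≤-refl
  M-≥ {suc N} {suc j} k≤N with m≤n⇒m<n∨m≡n k≤N
  ... | inj₂ refl = ≤-reflexive (sym (M-diagonal j))
  ... | inj₁ k<N  = subst (suc N ≤_) (sym (M-suc j (s≤s⁻¹ k<N)))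
    (m+n≤o⇒m≤o (suc N) (Riter-growth (iterations N j) k<N))

  r1-IsR1 : ∀ N j → 2 + j ≤ N → let m = M r1 R N (2 + j) in IsR1 m m (suc j) (r1 m (suc j))
  r1-IsR1 N j k≤N = hr1 _ _ (≤-trans (<⇒≤ k≤N) (M-≥ k≤N))

  -- Strictness leaves a last level above the `r` levels that are kept. A gain of one point per
  -- Ramsey iteration is enough, by `brack-growth`.
  r1<M : ∀ {N} j → 2 + j ≤ N → r1 (M r1 R N (2 + j)) (suc j) < M r1 R (suc N) (2 + j)
  r1<M {N} j k≤N = begin-strict
    r                            <⟨ brack-growth j<r ⟩
    iterations N j + suc j       ≤⟨ +-monoʳ-≤ (iterations N j) (≤-trans (<⇒≤ k≤N) (n≤1+n N)) ⟩
    iterations N j + suc N       ≡⟨ +-comm (iterations N j) (suc N) ⟩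
    suc N + iterations N j       ≤⟨ Riter-growth (iterations N j) (s≤s k≤N) ⟩
    Riter R (iterations N j) (suc N) (2 + j) ≡⟨ M-suc j k≤N ⟨
    M r1 R (suc N) (2 + j)       ∎
    where
    open ≤-Reasoning
    r = r1 (M r1 R N (2 + j)) (suc j)
    j<r : suc j ≤ r
    j<r = ≤-trans (<⇒≤ k≤N) (≤-trans (M-≥ k≤N) (≤-trans (m≤m⊔n _ _) (proj₁ (r1-IsR1 N j k≤N))))

  -- Induction on the excess `d` of the number of levels wanted over `k`; at `d = 0` the given stack
  -- itself has just `k` levels.
  topDetermined-substack : ∀ j d {L} → Stack (M r1 R (d + (2 + j)) (2 + j)) L → Sorted (flat L) → ∀ c →
    ∃ λ Z → Stack (d + (2 + j)) Z × Z ⊑ L × TopDetermined (2 + j) c Z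
  topDetermined-substack j zero {L} s o c =
    let s′ = subst (λ n → Stack n L) (M-diagonal j) s in L , s′ , ⊑-refl , topDetermined-short c ≤-refl s′
  topDetermined-substack j (suc d) {L} s o c = step (r1<M j k≤N) (M-suc j k≤N) s o
    where
    k = 2 + j
    N = d + k
    k≤N : k ≤ N
    k≤N = m≤n+m k d
    r = r1 (M r1 R N k) (suc j)
    -- Here `m` stands for M_{N+1,k}; as a variable it can be seen from `r < m` to be a successor,
    -- which exposes the last level `z`.
    step : ∀ {m L} → r < m → m ≡ Riter R (iterations N j) (suc N) k → Stack m L → Sorted (flat L) →
      ∃ λ Z → Stack (suc N) Z × Z ⊑ L × TopDetermined k c Z
    step (s≤s r≤m) m≡ (_∷_ {w = z} {L = L} e sL) o = result
      where
      A = trim r≤m sL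
      K = proj₁ A
      sK = proj₁ (proj₂ A)
      K⊑L = proj₂ (proj₂ A)
      cs : List (List ℕ → Bool)
      cs = map (λ W u → c (u ∷ W)) (substacks (suc j) K)
      length-cs : length cs ≡ iterations N j
      length-cs = trans (length-map _ (substacks (suc j) K)) (length-substacks (suc j) sK)
      result : _
      result
        with s , s⊆z , es , homs ← Riter⇒Homogeneous {suc N} {k} cs z
               (trans e (trans m≡ (cong (λ l → Riter R l (suc N) k) (sym length-cs))))
        with k≤∣s∣ ← subst (k ≤_) (sym es) (≤-trans k≤N (n≤1+n N))
        -- Since `s` is homogeneous for each `(k-1)`-stack of `K`, any `k` of its elements may
        -- represent the last level; `take k s` is one choice.
        with b , K′ , sK′ , K′⊑K , mono ← NoDraw⇒MonoStack (proj₁ (proj₂ (r1-IsR1 N j k≤N))) sK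
               (AllPairs-resp-⊆ (⊆-trans (flat-mono K⊑L) (⊆-++⁺ʳ z ⊆-refl)) o) (λ W → c (take k s ∷ W))
        with Z , sZ , Z⊑K′ , td ← topDetermined-substack j d sK′
               (AllPairs-resp-⊆ (⊆-trans (flat-mono (⊑-trans K′⊑K K⊑L)) (⊆-++⁺ʳ z ⊆-refl)) o) c
        = s ∷ Z , es ∷ sZ , s⊆z ∷ ⊑-trans Z⊑K′ (⊑-trans K′⊑K K⊑L) , ((λ _ → b) , top) ∷ td
        where
        top : ∀ {w W} → w ⊆ s → W ⊑ Z → Stack k (w ∷ W) → ∃ λ x → x ∈ w × c (w ∷ W) ≡ b
        top {w} {W} w⊆ W⊑ (ew ∷ sW) =
          let W⊑K′ = ⊑-trans W⊑ Z⊑K′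
              x , x∈ = nonempty ew
              _ , hom = All.lookup (All-map⁻ homs) (∈-substacks sW (⊑-trans W⊑K′ K′⊑K))
          -- Homogeneity replaces `w` by `take k s`; the choice of `K′` then gives `b`.
          in x , x∈ , trans (hom w⊆ ew)
               (trans (sym (hom (take-⊆ k s) (trans (length-take k s) (m≤n⇒m⊓n≡m k≤∣s∣)))) (mono W sW W⊑K′))

  topDetermined-exists : ∀ {N} k → suc k ≤ N → ∀ {L} → Stack (M r1 R N (suc k)) L → Sorted (flat L) → ∀ c →
    ∃ λ Z → Stack N Z × Z ⊑ L × TopDetermined (suc k) c Z
  topDetermined-exists {suc N} zero _ s o c = _ , s , ⊑-refl , topDetermined-1 c _
  topDetermined-exists {N} (suc j) k≤N rewrite sym (m∸n+n≡m k≤N) = topDetermined-substack j (N ∸ (2 + j))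

  M-NoDraw : ∀ n k → 1 ≤ k → k ≤ n → NoDraw n n k (M r1 R (2 * n ∸ 1) k)
  M-NoDraw n (suc k) _ k≤n B tri@(lB , eB) c
    with Z , sZ , Z⊑ , td ← topDetermined-exists k (≤-trans k≤n (n≤2n∸1 n)) (levels-stack B _ ≤-refl eB)
           (subst Sorted (sym (flat-levels B (M r1 R (2 * n ∸ 1) (suc k)) eB)) (Linked⇒AllPairs <-trans lB)) (c ∘ flat)
    with p , q , N≤ , red , blue ← mono-pair sZ td
    with 2n∸1≤p+q⇒ n N≤
  ... | inj₁ n≤p = inj₁ (MonoStack⇒WinsWith tri c (mono-⊑ Z⊑ (mono-trim n≤p red)))
  ... | inj₂ n≤q = inj₂ (MonoStack⇒WinsWith tri c (mono-⊑ Z⊑ (mono-trim n≤q blue)))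

theorem7 : (r1 R : ℕ → ℕ → ℕ) →
    (∀ n k → k ≤ n → IsR1 n n k (r1 n k)) →
    (∀ n k → IsRamsey n k (R n k)) →
    ∀ n k → 1 ≤ k → k ≤ n → r1 n k ≤ M r1 R (2 * n ∸ 1) k
theorem7 r1 R hr1 hR n (suc k) 1≤k k≤n =
  -- By minimality of `r1 n k` it is enough that `m` is admissible: `n ≤ 2n-1 ≤ m`, and no game on
  -- `m` levels is a draw.
  proj₂ (proj₂ (hr1 n (suc k) k≤n)) m (subst (_≤ m) (sym (⊔-idem n)) (≤-trans le (M-≥ r1 R hr1 hR (≤-trans k≤n le))))
    (M-NoDraw r1 R hr1 hR n (suc k) 1≤k k≤n)
  where
  m = M r1 R (2 * n ∸ 1) (suc k)
  le = n≤2n∸1 n
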